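{- Let $k\ge 2$ and let $r,s$ be integers with $1\le r\le s$. Then $D_{r,2,s}$ is a $\mathsf{TS}_k$-graph if and only if $s\le k-1$.
   Context: Graphs are finite, simple and undirected. For a graph $G$ and an integer $k\ge 2$, $\mathsf{TS}_k(G)$ is the graph whose nodes are all size-$k$ independent sets of $G$, two nodes $I,J$ being adjacent if there are vertices $u,v$ of $G$ with $I\setminus J=\{u\}$, $J\setminus I=\{v\}$ and $uv\in E(G)$. A graph is a $\mathsf{TS}_k$-graph if it is isomorphic to $\mathsf{TS}_k(G)$ for some graph $G$. $D_{r,2,s}$ is the tree obtained from a single edge $p_1p_2$ by attaching $r$ leaves to $p_1$ and $s$ leaves to $p_2$. -}

module Defs where

import Data.Bool.Properties as Bool
open import Data.Fin.Base using (Fin)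
open import Data.Fin.Properties using (any?)
open import Data.Fin.Subset using (Subset; _∈_; _─_; ⁅_⁆; ∣_∣; inside; outside)
open import Data.Fin.Subset.Properties using (x∈⁅x⁆)
open import Data.Nat.Base using (ℕ)
open import Data.Product.Base using (∃₂; Σ-syntax; ∃-syntax; _×_; _,_)
open import Data.Refinement.Base using (Refinement-syntax; value)
open import Data.Sum.Base using (_⊎_; inj₁; inj₂)
open import Data.Vec.Base using (_∷_; there)
open import Data.Vec.Properties using (≡-dec)
open import Function.Bundles using (_↔_; _⇔_; Inverse)
open import Level using (0ℓ)
open import Relation.Binary.Construct.Closure.Symmetric using (SymClosure; fwd; bwd; symmetric)
open import Relation.Binary.Core using (Rel)
open import Relation.Binary.Definitions using (Decidable; Irreflexive; Symmetric)
open import Relation.Binary.PropositionalEquality.Core using (_≡_; refl; sym; subst)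
open import Relation.Nullary.Decidable using (yes; no; map′; _×-dec_; _⊎-dec_)
open import Relation.Nullary.Negation using (¬_)

record SimpleGraph (V : Set) : Set₁ where
  field
    Adj        : Rel V 0ℓ
    adj-sym    : Symmetric Adj
    adj-irrefl : Irreflexive _≡_ Adj
    adj?       : Decidable Adj

open SimpleGraph public

infix 4 _≅_

_≅_ : {V W : Set} → SimpleGraph V → SimpleGraph W → Set
_≅_ {V} {W} G H =
  Σ[ f ∈ V ↔ W ] (∀ u v → Adj G u v ⇔ Adj H (Inverse.to f u) (Inverse.to f v))

module _ {n : ℕ} (G : SimpleGraph (Fin n)) where

  Independent : Subset n → Set
  Independent I = ∀ {u v} → u ∈ I → v ∈ I → ¬ Adj G u v

  -- A refinement type carries its proof irrelevantly, so two nodes are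
  -- equal as soon as their underlying vertex sets are.
  IndependentSet : ℕ → Set
  IndependentSet k = [ I ∈ Subset n ∣ Independent I × ∣ I ∣ ≡ k ]

  TokenSlide : Rel (Subset n) 0ℓ
  TokenSlide I J = ∃₂ λ u v → I ─ J ≡ ⁅ u ⁆ × J ─ I ≡ ⁅ v ⁆ × Adj G u v

  private
    ∉p─p : ∀ {m} (p : Subset m) {x} → ¬ (x ∈ p ─ p)
    ∉p─p (inside  ∷ p) (there x∈) = ∉p─p p x∈
    ∉p─p (outside ∷ p) (there x∈) = ∉p─p p x∈

    tokenSlide? : Decidable TokenSlide
    tokenSlide? I J = any? λ u → any? λ v →
      ≡-dec Bool._≟_ (I ─ J) ⁅ u ⁆ ×-dec ≡-dec Bool._≟_ (J ─ I) ⁅ v ⁆ ×-dec adj? G u v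

  TS : (k : ℕ) → SimpleGraph (IndependentSet k)
  TS k .Adj I J = TokenSlide (value I) (value J)
  TS k .adj-sym (u , v , I─J , J─I , uv) = v , u , J─I , I─J , adj-sym G uv
  TS k .adj-irrefl {I} refl (u , _ , I─I , _) =
    ∉p─p (value I) (subst (u ∈_) (sym I─I) (x∈⁅x⁆ u))
  TS k .adj? I J = tokenSlide? (value I) (value J)

-- Every finite graph is, up to isomorphism, a graph on some Fin n.
IsTSGraph : (k : ℕ) {V : Set} → SimpleGraph V → Set₁
IsTSGraph k H = ∃[ n ] Σ[ G ∈ SimpleGraph (Fin n) ] H ≅ TS G k

data DVertex (r s : ℕ) : Set where
  p₁ p₂ : DVertex r s
  leaf₁ : Fin r → DVertex r s
  leaf₂ : Fin s → DVertex r s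

data DEdge {r s : ℕ} : Rel (DVertex r s) 0ℓ where
  p₁p₂    : DEdge p₁ p₂
  p₁leaf₁ : ∀ i → DEdge p₁ (leaf₁ i)
  p₂leaf₂ : ∀ j → DEdge p₂ (leaf₂ j)

private
  dEdge? : ∀ {r s} → Decidable (DEdge {r} {s})
  dEdge? p₁        p₁        = no λ ()
  dEdge? p₁        p₂        = yes p₁p₂
  dEdge? p₁        (leaf₁ i) = yes (p₁leaf₁ i)
  dEdge? p₁        (leaf₂ _) = no λ ()
  dEdge? p₂        p₁        = no λ ()
  dEdge? p₂        p₂        = no λ ()
  dEdge? p₂        (leaf₁ _) = no λ ()
  dEdge? p₂        (leaf₂ j) = yes (p₂leaf₂ j)
  dEdge? (leaf₁ _) _         = no λ ()
  dEdge? (leaf₂ _) _         = no λ ()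

  toSym : ∀ {r s} {x y : DVertex r s} → DEdge x y ⊎ DEdge y x → SymClosure DEdge x y
  toSym (inj₁ e) = fwd e
  toSym (inj₂ e) = bwd e

  fromSym : ∀ {r s} {x y : DVertex r s} → SymClosure DEdge x y → DEdge x y ⊎ DEdge y x
  fromSym (fwd e) = inj₁ e
  fromSym (bwd e) = inj₂ e

D[_,2,_] : (r s : ℕ) → SimpleGraph (DVertex r s)
D[ r ,2, s ] .Adj                     = SymClosure DEdge
D[ r ,2, s ] .adj-sym                 = symmetric DEdge
D[ r ,2, s ] .adj-irrefl refl (fwd ())
D[ r ,2, s ] .adj-irrefl refl (bwd ())
D[ r ,2, s ] .adj? x y                = map′ toSym fromSym (dEdge? x y ⊎-dec dEdge? y x)

{-# OPTIONS --safe #-}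
module Submission where

-- Necessity: let I, of size k, be the node p₂. If two neighbours of I arise
-- by sliding the same token a to b and to b′, then b and b′ are not adjacent
-- (the tree has no triangle), so for any other c ∈ I the set I − a − c + b + b′
-- is a node. It differs from I in two tokens, hence is reached from I through
-- p₁, but c can be slid to neither b nor b′. So the s + 1 neighbours of I move
-- distinct tokens, and s + 1 ≤ k.
--
-- Sufficiency: partition the vertices into k cliques, so that every node of
-- size k picks one vertex from each, and is a map Fin k → Fin 3. Take p₂
-- constantly 0, let p₁ change the value at position 0, and let the leaves of
-- either centre change one further position each; s ≤ k − 1 says that there
-- are enough positions. Adjacency is then differing at a single position.

open import Defs
open import Data.Bool.Base using (true; false; if_then_else_)
open import Data.Empty using (⊥; ⊥-elim-irr)
open import Data.Fin.Base using (Fin; zero; suc; combine; quotient; remainder; punchOut; inject≤)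
open import Data.Fin.Patterns using (0F; 1F; 2F)
open import Data.Fin.Properties
  using (_≟_; any?; injective⇒≤; punchOut-injective; suc-injective; inject≤-injective;
         combine-remQuot; remQuot-combine)
open import Data.Fin.Subset using (Subset; inside; outside; _∈_; _∉_; _∩_; _∪_; _─_; _-_; ⁅_⁆; ∣_∣)
open import Data.Fin.Subset.Properties
  using (_∈?_; x∈⁅x⁆; x∈⁅y⁆⇒x≡y; ⊆-antisym; x∈p∧x∉q⇒x∈p─q; x∈p∧x≢y⇒x∈p-y; p─q⊆p; x∈p∪q⁺; x∈p∪q⁻;
         ∩-comm; p⊆q⇒∣p∣≤∣q∣; ∣⁅x⁆∣≡1)
open import Data.Irrelevant using ([_])
open import Data.Nat.Base using (ℕ; zero; suc; s≤s; s≤s⁻¹; _+_; _*_; _≤_; _∸_)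
import Data.Nat.Properties as ℕ
open import Data.Product.Base using (∃; _×_; _,_; proj₁; proj₂)
open import Data.Refinement using (_,_; value; value-injective)
open import Data.Sum.Base using (_⊎_; inj₁; inj₂; [_,_]′)
open import Data.Vec.Base using (_∷_; []; here; there; tabulate)
open import Data.Vec.Properties using ([]=⇒lookup; lookup⇒[]=; lookup∘tabulate)
open import Function.Base using (_∘_; id; case_of_)
open import Function.Bundles using (_⇔_; Equivalence; Inverse; mk⇔; mk↔ₛ′)
open import Relation.Binary.Construct.Closure.Symmetric using (fwd; bwd)
open import Relation.Binary.PropositionalEquality
  using (_≡_; _≢_; refl; sym; trans; cong; cong₂; subst; ≢-sym)
open import Relation.Nullary.Decidable
  using (Dec; yes; no; does; map′; recompute; decidable-stable; dec-true; dec-false; ¬?; _×-dec_; _⊎-dec_)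
open import Relation.Nullary.Negation using (¬_; contradiction)
open import Relation.Unary using (Decidable)

private
  variable
    k n : ℕ
    p q : Subset n

-- Counting through injections

rank : ∀ {x} → x ∈ p → Fin ∣ p ∣
rank {p = inside  ∷ p} here       = zero
rank {p = inside  ∷ p} (there x∈) = suc (rank x∈)
rank {p = outside ∷ p} (there x∈) = rank x∈

rank-injective : ∀ {x y} (x∈ : x ∈ p) (y∈ : y ∈ p) → rank x∈ ≡ rank y∈ → x ≡ y
rank-injective {p = inside  ∷ p} here       here       _  = refl
rank-injective {p = inside  ∷ p} (there x∈) (there y∈) eq =
  cong suc (rank-injective x∈ y∈ (suc-injective eq))
rank-injective {p = outside ∷ p} (there x∈) (there y∈) eq =
  cong suc (rank-injective x∈ y∈ eq)

element : (p : Subset n) → Fin ∣ p ∣ → Fin n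
element (inside  ∷ p) zero    = zero
element (inside  ∷ p) (suc i) = suc (element p i)
element (outside ∷ p) i       = suc (element p i)

element-∈ : (p : Subset n) (i : Fin ∣ p ∣) → element p i ∈ p
element-∈ (inside  ∷ p) zero    = here
element-∈ (inside  ∷ p) (suc i) = there (element-∈ p i)
element-∈ (outside ∷ p) i       = there (element-∈ p i)

element-injective : (p : Subset n) {i j : Fin ∣ p ∣} → element p i ≡ element p j → i ≡ j
element-injective (inside  ∷ p) {zero}  {zero}  _  = refl
element-injective (inside  ∷ p) {suc i} {suc j} eq =
  cong suc (element-injective p (suc-injective eq))
element-injective (outside ∷ p) eq = element-injective p (suc-injective eq)

injection⇒≤∣p∣ : (f : Fin k → Fin n) → (∀ {i j} → f i ≡ f j → i ≡ j) →
                 (∀ i → f i ∈ p) → k ≤ ∣ p ∣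
injection⇒≤∣p∣ f f-inj f∈ =
  injective⇒≤ λ {i} {j} eq → f-inj (rank-injective (f∈ i) (f∈ j) eq)

InjectiveOn : Subset n → (Fin n → Fin k) → Set
InjectiveOn p f = ∀ {x y} → x ∈ p → y ∈ p → f x ≡ f y → x ≡ y

injectiveOn⇒∣p∣≤ : (f : Fin n → Fin k) → InjectiveOn p f → ∣ p ∣ ≤ k
injectiveOn⇒∣p∣≤ {p = p} f f-inj =
  injective⇒≤ λ eq → element-injective p (f-inj (element-∈ p _) (element-∈ p _) eq)

-- Pigeonhole: if `c` were missed, punching it out of the codomain would inject the elements of `p`
-- into a `Fin` that is one smaller.
injectiveOn⇒surjectiveOn : (f : Fin n → Fin k) → InjectiveOn p f → ∣ p ∣ ≡ k →
                           ∀ c → ∃ λ x → x ∈ p × f x ≡ c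
injectiveOn⇒surjectiveOn {k = suc k} {p = p} f f-inj ∣p∣≡k c
  with any? (λ x → (x ∈? p) ×-dec (f x ≟ c))
... | yes hit = hit
... | no miss = contradiction (subst (_≤ k) ∣p∣≡k (injective⇒≤ g-inj)) ℕ.1+n≰n
  where
  avoids : ∀ i → c ≢ f (element p i)
  avoids i eq = miss (element p i , element-∈ p i , sym eq)

  g : Fin ∣ p ∣ → Fin k
  g i = punchOut (avoids i)

  g-inj : ∀ {i j} → g i ≡ g j → i ≡ j
  g-inj {i} {j} eq = element-injective p
    (f-inj (element-∈ p i) (element-∈ p j) (punchOut-injective (avoids i) (avoids j) eq))

-- Differences of subsets

∣p∣≡∣p∩q∣+∣p─q∣ : (p q : Subset n) → ∣ p ∣ ≡ ∣ p ∩ q ∣ + ∣ p ─ q ∣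
∣p∣≡∣p∩q∣+∣p─q∣ []            []            = refl
∣p∣≡∣p∩q∣+∣p─q∣ (inside  ∷ p) (inside  ∷ q) = cong suc (∣p∣≡∣p∩q∣+∣p─q∣ p q)
∣p∣≡∣p∩q∣+∣p─q∣ (inside  ∷ p) (outside ∷ q) =
  trans (cong suc (∣p∣≡∣p∩q∣+∣p─q∣ p q)) (sym (ℕ.+-suc _ _))
∣p∣≡∣p∩q∣+∣p─q∣ (outside ∷ p) (inside  ∷ q) = ∣p∣≡∣p∩q∣+∣p─q∣ p q
∣p∣≡∣p∩q∣+∣p─q∣ (outside ∷ p) (outside ∷ q) = ∣p∣≡∣p∩q∣+∣p─q∣ p q

x∈p─q⇒x∉q : (p q : Subset n) → ∀ {x} → x ∈ p ─ q → x ∉ q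
x∈p─q⇒x∉q (_ ∷ p) (inside  ∷ q) ()         here
x∈p─q⇒x∉q (_ ∷ p) (inside  ∷ q) (there x∈) (there x∈q) = x∈p─q⇒x∉q p q x∈ x∈q
x∈p─q⇒x∉q (_ ∷ p) (outside ∷ q) (there x∈) (there x∈q) = x∈p─q⇒x∉q p q x∈ x∈q

-- Elementwise form of `p ─ q ≡ ⁅ x ⁆`; `≡⇒difference` and `difference⇒≡` pass between the two.
record Difference (p q : Subset n) (x : Fin n) : Set where
  field
    ∈ˡ     : x ∈ p
    ∉ʳ     : x ∉ q
    unique : ∀ {y} → y ∈ p → y ∉ q → y ≡ x

  others : ∀ {y} → y ∈ p → y ≢ x → y ∈ q
  others y∈p y≢x = decidable-stable (_ ∈? q) (y≢x ∘ unique y∈p)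

open Difference

≡⇒difference : ∀ {x} → p ─ q ≡ ⁅ x ⁆ → Difference p q x
≡⇒difference {p = p} {q = q} {x} eq = record
  { ∈ˡ     = p─q⊆p p q x∈p─q
  ; ∉ʳ     = x∈p─q⇒x∉q p q x∈p─q
  ; unique = λ y∈p y∉q → x∈⁅y⁆⇒x≡y x (subst (_ ∈_) eq (x∈p∧x∉q⇒x∈p─q y∈p y∉q))
  }
  where
  x∈p─q : x ∈ p ─ q
  x∈p─q = subst (x ∈_) (sym eq) (x∈⁅x⁆ x)

difference⇒≡ : ∀ {x} → Difference p q x → p ─ q ≡ ⁅ x ⁆
difference⇒≡ {p = p} {q = q} {x} d = ⊆-antisym
  (λ y∈ → subst (_∈ ⁅ x ⁆) (sym (unique d (p─q⊆p p q y∈) (x∈p─q⇒x∉q p q y∈))) (x∈⁅x⁆ x))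
  (λ y∈ → subst (_∈ p ─ q) (sym (x∈⁅y⁆⇒x≡y x y∈)) (x∈p∧x∉q⇒x∈p─q (∈ˡ d) (∉ʳ d)))

-- Each set consists of the common part and one further element.
differences⇒∣p∣≡∣q∣ : ∀ {x y} → Difference p q x → Difference q p y → ∣ p ∣ ≡ ∣ q ∣
differences⇒∣p∣≡∣q∣ {p = p} {q = q} {x} {y} dₓ dᵧ = begin
  ∣ p ∣                   ≡⟨ ∣p∣≡∣p∩q∣+∣p─q∣ p q ⟩
  ∣ p ∩ q ∣ + ∣ p ─ q ∣   ≡⟨ cong₂ (λ a b → ∣ a ∣ + b) (∩-comm p q) ∣p─q∣≡∣q─p∣ ⟩
  ∣ q ∩ p ∣ + ∣ q ─ p ∣   ≡⟨ ∣p∣≡∣p∩q∣+∣p─q∣ q p ⟨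
  ∣ q ∣                   ∎
  where
  open Relation.Binary.PropositionalEquality.≡-Reasoning
  ∣p─q∣≡∣q─p∣ : ∣ p ─ q ∣ ≡ ∣ q ─ p ∣
  ∣p─q∣≡∣q─p∣ = trans (trans (cong ∣_∣ (difference⇒≡ dₓ)) (∣⁅x⁆∣≡1 x))
                      (sym (trans (cong ∣_∣ (difference⇒≡ dᵧ)) (∣⁅x⁆∣≡1 y)))

another-element : ∀ (p : Subset n) x → 2 ≤ ∣ p ∣ → ∃ λ y → y ∈ p × y ≢ x
another-element p x 2≤∣p∣ with any? (λ y → (y ∈? p) ×-dec ¬? (y ≟ x))
... | yes found = found
... | no none = contradiction
  (ℕ.≤-trans 2≤∣p∣ (subst (∣ p ∣ ≤_) (∣⁅x⁆∣≡1 x) (p⊆q⇒∣p∣≤∣q∣ p⊆⁅x⁆))) ℕ.1+n≰n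
  where
  p⊆⁅x⁆ : ∀ {y} → y ∈ p → y ∈ ⁅ x ⁆
  p⊆⁅x⁆ {y} y∈p with y ≟ x
  ... | yes refl = x∈⁅x⁆ x
  ... | no y≢x   = contradiction (y , y∈p , y≢x) none

-- Recovering the irrelevant properties of nodes

module _ (G : SimpleGraph (Fin n)) where

  -- The certificate of a node is irrelevant, but its content can still be used: independence ends
  -- in a contradiction, and the equation in `size` is decidable.
  independent : (S : IndependentSet G k) → Independent G (value S)
  independent (_ , [ S-node ]) u∈ v∈ uv = ⊥-elim-irr (proj₁ S-node u∈ v∈ uv)

  size : (S : IndependentSet G k) → ∣ value S ∣ ≡ k
  size (S , [ S-node ]) = recompute (∣ S ∣ ℕ.≟ _) (proj₂ S-node)

-- Reconfiguration graphs of transversals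

-- Hamming distance one.
DiffersOnce : {A : Set} → (Fin k → A) → (Fin k → A) → Set
DiffersOnce σ τ = ∃ λ i → σ i ≢ τ i × (∀ j → σ j ≢ τ j → j ≡ i)

differsOnce-sym : {A : Set} {σ τ : Fin k → A} → DiffersOnce σ τ → DiffersOnce τ σ
differsOnce-sym (i , σi≢τi , uniq) = i , ≢-sym σi≢τi , λ j → uniq j ∘ ≢-sym

module Transversals (k q : ℕ) where

  -- A vertex is a pair of a position, its colour, and a value, its kind, packed by `combine`. The
  -- transversal of `σ` is then the graph of the map `σ`.
  colour : Fin (k * q) → Fin k
  colour = quotient q

  kind : Fin (k * q) → Fin q
  kind = remainder {k} q

  vertex-≡ : ∀ {u v} → colour u ≡ colour v → kind u ≡ kind v → u ≡ v
  vertex-≡ {u} {v} c≡ k≡ = trans (sym (combine-remQuot {k} q u))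
    (trans (cong₂ combine c≡ k≡) (combine-remQuot {k} q v))

  colour-combine : ∀ i x → colour (combine i x) ≡ i
  colour-combine i x = cong proj₁ (remQuot-combine {k} i x)

  kind-combine : ∀ i x → kind (combine i x) ≡ x
  kind-combine i x = cong proj₂ (remQuot-combine {k} i x)

  opaque
    transversal : (Fin k → Fin q) → Subset (k * q)
    transversal σ = tabulate λ v → does (σ (colour v) ≟ kind v)

    ∈-transversal⁺ : ∀ {σ v} → σ (colour v) ≡ kind v → v ∈ transversal σ
    ∈-transversal⁺ {σ} {v} eq = lookup⇒[]= v _
      (trans (lookup∘tabulate _ v) (dec-true (σ (colour v) ≟ kind v) eq))

    ∈-transversal⁻ : ∀ {σ v} → v ∈ transversal σ → σ (colour v) ≡ kind v
    ∈-transversal⁻ {σ} {v} v∈ = decidable-stable (σ (colour v) ≟ kind v) λ neq →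
      case trans (sym (dec-false (σ (colour v) ≟ kind v) neq))
                 (trans (sym (lookup∘tabulate _ v)) ([]=⇒lookup v∈)) of λ ()

  combine-∈⁺ : ∀ {σ i x} → σ i ≡ x → combine i x ∈ transversal σ
  combine-∈⁺ {σ} {i} {x} eq = ∈-transversal⁺
    (trans (cong σ (colour-combine i x)) (trans eq (sym (kind-combine i x))))

  combine-∈⁻ : ∀ {σ i x} → combine i x ∈ transversal σ → σ i ≡ x
  combine-∈⁻ {σ} {i} {x} ∈σ = trans (cong σ (sym (colour-combine i x)))
    (trans (∈-transversal⁻ ∈σ) (kind-combine i x))

  combine-injective : ∀ {i j x y} → combine {k} {q} i x ≡ combine j y → i ≡ j
  combine-injective {i} {j} {x} {y} eq =
    trans (sym (colour-combine i x)) (trans (cong colour eq) (colour-combine j y))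

  colour-injectiveOn : ∀ σ → InjectiveOn (transversal σ) colour
  colour-injectiveOn σ u∈ v∈ c≡ = vertex-≡ c≡
    (trans (sym (∈-transversal⁻ u∈)) (trans (cong σ c≡) (∈-transversal⁻ v∈)))

  -- Colours inject the transversal into `Fin k`, and `i ↦ combine i (σ i)` injects `Fin k` back
  -- into it.
  ∣transversal∣ : ∀ σ → ∣ transversal σ ∣ ≡ k
  ∣transversal∣ σ = ℕ.≤-antisym
    (injectiveOn⇒∣p∣≤ colour (colour-injectiveOn σ))
    (injection⇒≤∣p∣ (λ i → combine i (σ i)) combine-injective λ i → combine-∈⁺ refl)

  differsOnce⇒difference : ∀ {σ τ} ((i , _) : DiffersOnce σ τ) →
    Difference (transversal σ) (transversal τ) (combine i (σ i))
  differsOnce⇒difference {σ} {τ} (i , σi≢τi , uniq) = record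
    { ∈ˡ     = combine-∈⁺ refl
    ; ∉ʳ     = λ ∈τ → σi≢τi (sym (combine-∈⁻ ∈τ))
    ; unique = λ {v} v∈σ v∉τ →
        let c≡i = uniq (colour v) λ σ≡τ → v∉τ (∈-transversal⁺ (trans (sym σ≡τ) (∈-transversal⁻ v∈σ)))
        in colour-injectiveOn σ v∈σ (combine-∈⁺ refl) (trans c≡i (sym (colour-combine i _)))
    }

  -- Every position `j` at which the maps differ puts its own vertex `combine j (σ j)` into the
  -- difference, so there is only one such position.
  difference⇒differsOnce : ∀ {σ τ u} → Difference (transversal σ) (transversal τ) u → DiffersOnce σ τ
  difference⇒differsOnce {σ} {τ} {u} d =
      colour u
    , (λ σ≡τ → ∉ʳ d (∈-transversal⁺ (trans (sym σ≡τ) (∈-transversal⁻ (∈ˡ d)))))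
    , λ j σ≢τ → trans (sym (colour-combine j (σ j)))
        (cong colour (unique d (combine-∈⁺ refl) λ ∈τ → σ≢τ (sym (combine-∈⁻ ∈τ))))

  -- The colour classes are made cliques and, otherwise, two vertices are
  -- joined unless some transversal of the family contains both. The Helly
  -- hypothesis then says that no further independent k-sets arise.
  differsOnce-isTSGraph :
    {D : Set} → (∀ {P : D → Set} → Decidable P → Dec (∃ P)) →
    (H : SimpleGraph D) (F : D → Fin k → Fin q) →
    (∀ {d e} → (∀ i → F d i ≡ F e i) → d ≡ e) →
    (∀ σ → (∀ i j → i ≢ j → ∃ λ d → F d i ≡ σ i × F d j ≡ σ j) → ∃ λ d → ∀ i → F d i ≡ σ i) →
    (∀ {d e} → Adj H d e → DiffersOnce (F d) (F e)) →
    (∀ {d e} → DiffersOnce (F d) (F e) → Adj H d e) →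
    IsTSGraph k H
  differsOnce-isTSGraph {D} search H F F-injective helly adj⇒ ⇒adj =
    k * q , G , mk↔ₛ′ to from to-from from-to , λ d e → mk⇔ (adj⇒slide d e) (slide⇒adj d e)
    where
    T : D → Subset (k * q)
    T d = transversal (F d)

    Compatible : Fin (k * q) → Fin (k * q) → Set
    Compatible u v = ∃ λ d → u ∈ T d × v ∈ T d

    -- Makes adjacency in `G` decidable, and later turns non-adjacency into an actual common
    -- transversal.
    compatible? : ∀ u v → Dec (Compatible u v)
    compatible? u v = search λ d → (u ∈? T d) ×-dec (v ∈? T d)

    G : SimpleGraph (Fin (k * q))
    G .Adj u v = u ≢ v × ¬ Compatible u v
    G .adj-sym (u≢v , ¬c) = ≢-sym u≢v , λ (d , v∈ , u∈) → ¬c (d , u∈ , v∈)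
    G .adj-irrefl u≡v (u≢v , _) = u≢v u≡v
    G .adj? u v = ¬? (u ≟ v) ×-dec ¬? (compatible? u v)

    T-independent : ∀ d → Independent G (T d)
    T-independent d u∈ v∈ (_ , ¬c) = ¬c (d , u∈ , v∈)

    clique : ∀ {u v} → colour u ≡ colour v → u ≢ v → Adj G u v
    clique {u} {v} c≡ u≢v = u≢v , λ (d , u∈ , v∈) → u≢v (colour-injectiveOn (F d) u∈ v∈ c≡)

    -- The colour classes are cliques, so `S` meets each at most once and, having `k` elements,
    -- exactly once. Hence `S` is the graph of a map `σ`. Any two of its vertices lie in a common
    -- member of the family, and the Helly hypothesis yields one member for all.
    independent⇒T : ∀ S → Independent G S → ∣ S ∣ ≡ k → ∃ λ d → T d ≡ S
    independent⇒T S ind ∣S∣≡k = proj₁ d∈ , ⊆-antisym T⊆S S⊆T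
      where
      colour-inj : InjectiveOn S colour
      colour-inj {u} {v} u∈ v∈ c≡ = decidable-stable (u ≟ v) (ind u∈ v∈ ∘ clique c≡)

      hit : ∀ i → ∃ λ v → v ∈ S × colour v ≡ i
      hit = injectiveOn⇒surjectiveOn colour colour-inj ∣S∣≡k

      rep : Fin k → Fin (k * q)
      rep = proj₁ ∘ hit

      rep-∈ : ∀ i → rep i ∈ S
      rep-∈ = proj₁ ∘ proj₂ ∘ hit

      colour-rep : ∀ i → colour (rep i) ≡ i
      colour-rep = proj₂ ∘ proj₂ ∘ hit

      σ : Fin k → Fin q
      σ i = kind (rep i)

      rep-∈T⇒ : ∀ {d} i → rep i ∈ T d → F d i ≡ σ i
      rep-∈T⇒ {d} i ∈T = trans (cong (F d) (sym (colour-rep i))) (∈-transversal⁻ ∈T)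

      compatible : ∀ i j → i ≢ j → ∃ λ d → F d i ≡ σ i × F d j ≡ σ j
      compatible i j i≢j =
        -- Independence of `S` only refutes incompatibility; decidability gives the member `d`.
        let (d , i∈T , j∈T) = decidable-stable (compatible? (rep i) (rep j))
              λ ¬c → ind (rep-∈ i) (rep-∈ j) (rep≢ , ¬c)
        in d , rep-∈T⇒ i i∈T , rep-∈T⇒ j j∈T
        where
        rep≢ : rep i ≢ rep j
        rep≢ eq = i≢j (trans (sym (colour-rep i)) (trans (cong colour eq) (colour-rep j)))

      d∈ : ∃ λ d → ∀ i → F d i ≡ σ i
      d∈ = helly σ compatible

      T⊆S : ∀ {v} → v ∈ T (proj₁ d∈) → v ∈ S
      T⊆S {v} v∈ = subst (_∈ S) (vertex-≡ (colour-rep (colour v))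
        (trans (sym (proj₂ d∈ (colour v))) (∈-transversal⁻ v∈))) (rep-∈ (colour v))

      S⊆T : ∀ {v} → v ∈ S → v ∈ T (proj₁ d∈)
      S⊆T {v} v∈ = ∈-transversal⁺ (trans (proj₂ d∈ (colour v))
        (cong kind (colour-inj (rep-∈ (colour v)) v∈ (colour-rep (colour v)))))

    T-injective : ∀ {d e} → T d ≡ T e → d ≡ e
    T-injective {d} {e} eq = F-injective λ i →
      sym (combine-∈⁻ {x = F d i} (subst (combine i (F d i) ∈_) eq (combine-∈⁺ refl)))

    to : D → IndependentSet G k
    to d = T d , [ (λ {u} {v} → T-independent d {u} {v}) , ∣transversal∣ (F d) ]

    preimage : ∀ S → ∃ λ d → T d ≡ value S
    preimage S = independent⇒T (value S) (independent G S) (size G S)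

    from : IndependentSet G k → D
    from S = proj₁ (preimage S)

    to-from : ∀ S → to (from S) ≡ S
    to-from S = value-injective (proj₂ (preimage S))

    from-to : ∀ d → from (to d) ≡ d
    from-to d = T-injective (proj₂ (preimage (to d)))

    -- The token at the changed position slides inside its colour class, which is a clique.
    adj⇒slide : ∀ d e → Adj H d e → TokenSlide G (T d) (T e)
    adj⇒slide d e adj with (i , ≢ , uniq) ← adj⇒ adj =
        combine i (F d i) , combine i (F e i)
      , difference⇒≡ (differsOnce⇒difference (i , ≢ , uniq))
      , difference⇒≡ (differsOnce⇒difference (differsOnce-sym (i , ≢ , uniq)))
      , clique (trans (colour-combine i _) (sym (colour-combine i _)))
          (λ eq → ≢ (trans (sym (kind-combine i _)) (trans (cong kind eq) (kind-combine i _))))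

    slide⇒adj : ∀ d e → TokenSlide G (T d) (T e) → Adj H d e
    slide⇒adj d e (_ , _ , T─T , _) = ⇒adj (difference⇒differsOnce (≡⇒difference T─T))

-- Realising the double brooms

-- With `k` equal to `suc (suc m)`, the bound `suc m` counts the positions other than 0.
module Realisation {m r s : ℕ} (r≤m : r ≤ suc m) (s≤m : s ≤ suc m) where

  opaque
    spike : Fin n → Fin 3 → Fin n → Fin 3
    spike i x j = if does (i ≟ j) then x else 0F

    spike-≡ : ∀ (i : Fin n) x → spike i x i ≡ x
    spike-≡ i x rewrite dec-true (i ≟ i) refl = refl

    spike-≢ : ∀ {i j : Fin n} x → i ≢ j → spike i x j ≡ 0F
    spike-≢ {i = i} {j} x i≢j rewrite dec-false (i ≟ j) i≢j = refl

    spike-support : ∀ {i j : Fin n} x → spike i x j ≢ 0F → i ≡ j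
    spike-support {i = i} {j} x ≢0 = decidable-stable (i ≟ j) (≢0 ∘ spike-≢ x)

    spikes-differ : ∀ {i i′ j : Fin n} → spike i 2F j ≢ 0F → spike i 2F j ≢ spike i′ 1F j
    spikes-differ {i = i} {i′} {j} ≢0 eq with does (i ≟ j) | does (i′ ≟ j)
    ... | true  | true  = contradiction eq λ ()
    ... | true  | false = contradiction eq λ ()
    ... | false | _     = ≢0 refl

  spike-determines : ∀ {i i′ j : Fin n} x →
                     spike i x j ≢ 0F → spike i x j ≡ spike i′ x j → i ≡ i′
  spike-determines x ≢0 eq =
    trans (spike-support x ≢0) (sym (spike-support x (≢0 ∘ trans eq)))

  pos₁ : Fin r → Fin (suc m)
  pos₁ i = inject≤ i r≤m

  pos₂ : Fin s → Fin (suc m)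
  pos₂ j = inject≤ j s≤m

  -- Position 0 tells the two sides of the broom apart. Leaves of `p₁` spike with value 2 and leaves
  -- of `p₂` with value 1, so leaves of different centres may share a position.
  family : DVertex r s → Fin (suc (suc m)) → Fin 3
  family p₁        zero    = 1F
  family p₁        (suc _) = 0F
  family p₂        _       = 0F
  family (leaf₁ i) zero    = 1F
  family (leaf₁ i) (suc j) = spike (pos₁ i) 2F j
  family (leaf₂ i) zero    = 0F
  family (leaf₂ i) (suc j) = spike (pos₂ i) 1F j

  -- Away from position 0, a non-zero value identifies a leaf: the value gives its centre, the
  -- position gives its index.
  family-determines : ∀ {d e} j → family d (suc j) ≢ 0F →
                      family d (suc j) ≡ family e (suc j) → d ≡ e
  family-determines {p₁}      {_}        j ≢0 _  = contradiction refl ≢0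
  family-determines {p₂}      {_}        j ≢0 _  = contradiction refl ≢0
  family-determines {leaf₁ _} {p₁}       j ≢0 eq = contradiction eq ≢0
  family-determines {leaf₁ _} {p₂}       j ≢0 eq = contradiction eq ≢0
  family-determines {leaf₁ i} {leaf₁ i′} j ≢0 eq =
    cong leaf₁ (inject≤-injective r≤m r≤m i i′ (spike-determines 2F ≢0 eq))
  family-determines {leaf₁ i} {leaf₂ i′} j ≢0 eq =
    contradiction eq (spikes-differ ≢0)
  family-determines {leaf₂ _} {p₁}       j ≢0 eq = contradiction eq ≢0
  family-determines {leaf₂ _} {p₂}       j ≢0 eq = contradiction eq ≢0
  family-determines {leaf₂ i} {leaf₁ i′} j ≢0 eq =
    contradiction (sym eq) (spikes-differ (≢0 ∘ trans eq))
  family-determines {leaf₂ i} {leaf₂ i′} j ≢0 eq =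
    cong leaf₂ (inject≤-injective s≤m s≤m i i′ (spike-determines 1F ≢0 eq))

  leaf₁-spike : ∀ i → family (leaf₁ i) (suc (pos₁ i)) ≢ 0F
  leaf₁-spike i eq = case trans (sym (spike-≡ (pos₁ i) 2F)) eq of λ ()

  leaf₂-spike : ∀ i → family (leaf₂ i) (suc (pos₂ i)) ≢ 0F
  leaf₂-spike i eq = case trans (sym (spike-≡ (pos₂ i) 1F)) eq of λ ()

  family-injective : ∀ {d e} → (∀ i → family d i ≡ family e i) → d ≡ e
  family-injective {leaf₁ i} {_}       eq = family-determines (pos₁ i) (leaf₁-spike i) (eq (suc (pos₁ i)))
  family-injective {leaf₂ i} {_}       eq = family-determines (pos₂ i) (leaf₂-spike i) (eq (suc (pos₂ i)))
  family-injective {p₁}      {leaf₁ i} eq =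
    sym (family-determines (pos₁ i) (leaf₁-spike i) (sym (eq (suc (pos₁ i)))))
  family-injective {p₁}      {leaf₂ i} eq = contradiction (eq zero) λ ()
  family-injective {p₂}      {leaf₁ i} eq = contradiction (eq zero) λ ()
  family-injective {p₂}      {leaf₂ i} eq =
    sym (family-determines (pos₂ i) (leaf₂-spike i) (sym (eq (suc (pos₂ i)))))
  family-injective {p₁}      {p₁}      eq = refl
  family-injective {p₁}      {p₂}      eq = contradiction (eq zero) λ ()
  family-injective {p₂}      {p₁}      eq = contradiction (eq zero) λ ()
  family-injective {p₂}      {p₂}      eq = refl

  centre : ∀ d → ∃ λ c → family c zero ≡ family d zero × (∀ j → family c (suc j) ≡ 0F)
  centre p₁        = p₁ , refl , λ _ → refl
  centre p₂        = p₂ , refl , λ _ → refl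
  centre (leaf₁ _) = p₁ , refl , λ _ → refl
  centre (leaf₂ _) = p₂ , refl , λ _ → refl

  -- If `σ` is non-zero at some `suc j`, only one member has that value there, so the members given
  -- by the pairs containing `suc j` all coincide. Otherwise `σ` vanishes off position 0 and is one
  -- of the two centres.
  family-helly : ∀ (σ : Fin (suc (suc m)) → Fin 3) →
    (∀ i j → i ≢ j → ∃ λ d → family d i ≡ σ i × family d j ≡ σ j) →
    ∃ λ d → ∀ i → family d i ≡ σ i
  family-helly σ compatible with any? (λ j → ¬? (σ (suc j) ≟ 0F))
  ... | yes (j , σj≢0) = d , agrees
    where
    d : DVertex r s
    d = proj₁ (compatible zero (suc j) λ ())

    dj : family d (suc j) ≡ σ (suc j)
    dj = proj₂ (proj₂ (compatible zero (suc j) λ ()))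

    agrees : ∀ i → family d i ≡ σ i
    agrees i with i ≟ suc j
    ... | yes refl = dj
    ... | no i≢j =
      let (e , ei , ej) = compatible i (suc j) i≢j
          d≡e = family-determines {d} {e} j (σj≢0 ∘ trans (sym dj)) (trans dj (sym ej))
      in trans (cong (λ d → family d i) d≡e) ei
  ... | no all-0 =
    -- Position 1 exists because `k` is at least 2. The pair only serves to show that a member takes
    -- the value `σ zero`, which rules out 2.
    let (d , d0 , _)      = compatible zero (suc zero) λ ()
        (c , c0 , c-rest) = centre d
    in c , λ where
      zero    → trans c0 d0
      (suc j) → trans (c-rest j)
        (sym (decidable-stable (σ (suc j) ≟ 0F) λ ≢0 → all-0 (j , ≢0)))

  edge⇒differsOnce : ∀ {d e} → DEdge d e → DiffersOnce (family d) (family e)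
  edge⇒differsOnce p₁p₂ = zero , (λ ()) , λ where
    zero    _   → refl
    (suc _) neq → contradiction refl neq
  edge⇒differsOnce (p₁leaf₁ i) = suc (pos₁ i) , leaf₁-spike i ∘ sym , λ where
    zero    neq → contradiction refl neq
    (suc j) neq → cong suc (sym (spike-support 2F (neq ∘ sym)))
  edge⇒differsOnce (p₂leaf₂ i) = suc (pos₂ i) , leaf₂-spike i ∘ sym , λ where
    zero    neq → contradiction refl neq
    (suc j) neq → cong suc (sym (spike-support 1F (neq ∘ sym)))

  adj⇒differsOnce : ∀ {d e} → Adj D[ r ,2, s ] d e → DiffersOnce (family d) (family e)
  adj⇒differsOnce (fwd e) = edge⇒differsOnce e
  adj⇒differsOnce (bwd e) = differsOnce-sym (edge⇒differsOnce e)

  ¬differsOnce-refl : ∀ d → ¬ DiffersOnce (family d) (family d)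
  ¬differsOnce-refl d (_ , neq , _) = neq refl

  -- Excludes the pairs that the broom does not join: across the two sides the witnesses are
  -- position 0 and the position of a leaf, on one side the positions of the two leaves.
  differsTwice : ∀ d e i j → i ≢ j → family d i ≢ family e i → family d j ≢ family e j →
                 ¬ DiffersOnce (family d) (family e)
  differsTwice d e i j i≢j di≢ei dj≢ej (_ , _ , uniq) =
    i≢j (trans (uniq i di≢ei) (sym (uniq j dj≢ej)))

  ¬differsOnce-p₁-leaf₂ : ∀ i → ¬ DiffersOnce (family p₁) (family (leaf₂ i))
  ¬differsOnce-p₁-leaf₂ i =
    differsTwice p₁ (leaf₂ i) zero (suc (pos₂ i)) (λ ()) (λ ()) (leaf₂-spike i ∘ sym)

  ¬differsOnce-p₂-leaf₁ : ∀ i → ¬ DiffersOnce (family p₂) (family (leaf₁ i))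
  ¬differsOnce-p₂-leaf₁ i =
    differsTwice p₂ (leaf₁ i) zero (suc (pos₁ i)) (λ ()) (λ ()) (leaf₁-spike i ∘ sym)

  ¬differsOnce-leaf₁-leaf₂ : ∀ i j → ¬ DiffersOnce (family (leaf₁ i)) (family (leaf₂ j))
  ¬differsOnce-leaf₁-leaf₂ i j =
    differsTwice (leaf₁ i) (leaf₂ j) zero (suc (pos₁ i)) (λ ()) (λ ())
      (spikes-differ (leaf₁-spike i))

  ¬differsOnce-leaf₁-leaf₁ : ∀ i j → ¬ DiffersOnce (family (leaf₁ i)) (family (leaf₁ j))
  ¬differsOnce-leaf₁-leaf₁ i j δ with i ≟ j
  ... | yes refl = ¬differsOnce-refl (leaf₁ i) δ
  ... | no i≢j   = differsTwice (leaf₁ i) (leaf₁ j) (suc (pos₁ i)) (suc (pos₁ j))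
    (pos≢ ∘ suc-injective)
    (pos≢ ∘ spike-determines 2F (leaf₁-spike i))
    (pos≢ ∘ sym ∘ spike-determines 2F (leaf₁-spike j) ∘ sym)
    δ
    where
    pos≢ : pos₁ i ≢ pos₁ j
    pos≢ = i≢j ∘ inject≤-injective r≤m r≤m i j

  ¬differsOnce-leaf₂-leaf₂ : ∀ i j → ¬ DiffersOnce (family (leaf₂ i)) (family (leaf₂ j))
  ¬differsOnce-leaf₂-leaf₂ i j δ with i ≟ j
  ... | yes refl = ¬differsOnce-refl (leaf₂ i) δ
  ... | no i≢j   = differsTwice (leaf₂ i) (leaf₂ j) (suc (pos₂ i)) (suc (pos₂ j))
    (pos≢ ∘ suc-injective)
    (pos≢ ∘ spike-determines 1F (leaf₂-spike i))
    (pos≢ ∘ sym ∘ spike-determines 1F (leaf₂-spike j) ∘ sym)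
    δ
    where
    pos≢ : pos₂ i ≢ pos₂ j
    pos≢ = i≢j ∘ inject≤-injective s≤m s≤m i j

  differsOnce⇒adj : ∀ {d e} → DiffersOnce (family d) (family e) → Adj D[ r ,2, s ] d e
  differsOnce⇒adj {p₁}      {p₁}      δ = contradiction δ (¬differsOnce-refl p₁)
  differsOnce⇒adj {p₁}      {p₂}      δ = fwd p₁p₂
  differsOnce⇒adj {p₁}      {leaf₁ i} δ = fwd (p₁leaf₁ i)
  differsOnce⇒adj {p₁}      {leaf₂ i} δ = contradiction δ (¬differsOnce-p₁-leaf₂ i)
  differsOnce⇒adj {p₂}      {p₁}      δ = bwd p₁p₂
  differsOnce⇒adj {p₂}      {p₂}      δ = contradiction δ (¬differsOnce-refl p₂)
  differsOnce⇒adj {p₂}      {leaf₁ i} δ = contradiction δ (¬differsOnce-p₂-leaf₁ i)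
  differsOnce⇒adj {p₂}      {leaf₂ i} δ = fwd (p₂leaf₂ i)
  differsOnce⇒adj {leaf₁ i} {p₁}      δ = bwd (p₁leaf₁ i)
  differsOnce⇒adj {leaf₁ i} {p₂}      δ =
    contradiction (differsOnce-sym δ) (¬differsOnce-p₂-leaf₁ i)
  differsOnce⇒adj {leaf₁ i} {leaf₁ j} δ = contradiction δ (¬differsOnce-leaf₁-leaf₁ i j)
  differsOnce⇒adj {leaf₁ i} {leaf₂ j} δ = contradiction δ (¬differsOnce-leaf₁-leaf₂ i j)
  differsOnce⇒adj {leaf₂ i} {p₁}      δ =
    contradiction (differsOnce-sym δ) (¬differsOnce-p₁-leaf₂ i)
  differsOnce⇒adj {leaf₂ i} {p₂}      δ = bwd (p₂leaf₂ i)
  differsOnce⇒adj {leaf₂ i} {leaf₁ j} δ =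
    contradiction (differsOnce-sym δ) (¬differsOnce-leaf₁-leaf₂ j i)
  differsOnce⇒adj {leaf₂ i} {leaf₂ j} δ = contradiction δ (¬differsOnce-leaf₂-leaf₂ i j)

  search : ∀ {P : DVertex r s → Set} → Decidable P → Dec (∃ P)
  search {P} P? =
    map′ fromSum toSum (P? p₁ ⊎-dec P? p₂ ⊎-dec any? (P? ∘ leaf₁) ⊎-dec any? (P? ∘ leaf₂))
    where
    Sum : Set
    Sum = P p₁ ⊎ P p₂ ⊎ ∃ (P ∘ leaf₁) ⊎ ∃ (P ∘ leaf₂)

    fromSum : Sum → ∃ P
    fromSum (inj₁ p)                     = p₁ , p
    fromSum (inj₂ (inj₁ p))              = p₂ , p
    fromSum (inj₂ (inj₂ (inj₁ (i , p)))) = leaf₁ i , p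
    fromSum (inj₂ (inj₂ (inj₂ (i , p)))) = leaf₂ i , p

    toSum : ∃ P → Sum
    toSum (p₁ , p)      = inj₁ p
    toSum (p₂ , p)      = inj₂ (inj₁ p)
    toSum (leaf₁ i , p) = inj₂ (inj₂ (inj₁ (i , p)))
    toSum (leaf₂ i , p) = inj₂ (inj₂ (inj₂ (i , p)))

  D-isTSGraph : IsTSGraph (suc (suc m)) D[ r ,2, s ]
  D-isTSGraph = Transversals.differsOnce-isTSGraph (suc (suc m)) 3 search D[ r ,2, s ]
    family family-injective family-helly adj⇒differsOnce differsOnce⇒adj

-- Bounding the degree of p₂

module _ (G : SimpleGraph (Fin n)) where

  record Slide (I J : Subset n) (u v : Fin n) : Set where
    field
      leave : Difference I J u
      enter : Difference J I v
      edge  : Adj G u v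

  open Slide

  tokenSlide⇒slide : ∀ {I J} ((u , v , _) : TokenSlide G I J) → Slide I J u v
  tokenSlide⇒slide (_ , _ , I─J , J─I , uv) = record
    { leave = ≡⇒difference I─J ; enter = ≡⇒difference J─I ; edge = uv }

  -- Both slides take `a` away, so `J` is `I − a + b` and `J′` is `I − a + b′`. The two ends can
  -- differ only in `b` and `b′`.
  module Fork {I J J′ : Subset n} {a b b′ : Fin n}
              (ab : Slide I J a b) (ab′ : Slide I J′ a b′) where

    stays : ∀ {x} → x ∈ J → x ≢ b → x ∈ J′
    stays x∈J x≢b = others (leave ab′) (others (enter ab) x∈J x≢b)
      λ x≡a → ∉ʳ (leave ab) (subst (_∈ J) x≡a x∈J)

    b∉J′ : b ≢ b′ → b ∉ J′
    b∉J′ b≢b′ b∈J′ = b≢b′ (unique (enter ab′) b∈J′ (∉ʳ (enter ab)))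

    difference : b ≢ b′ → Difference J J′ b
    difference b≢b′ = record
      { ∈ˡ     = ∈ˡ (enter ab)
      ; ∉ʳ     = b∉J′ b≢b′
      ; unique = λ {x} x∈J x∉J′ → decidable-stable (x ≟ b) (x∉J′ ∘ stays x∈J)
      }

    J⊆J′ : b ≡ b′ → ∀ {x} → x ∈ J → x ∈ J′
    J⊆J′ refl {x} x∈J with x ≟ b
    ... | yes refl = ∈ˡ (enter ab′)
    ... | no x≢b   = stays x∈J x≢b

  module DoubleSlide {I J J′ : Subset n} {a b b′ c : Fin n}
                     (J-indep : Independent G J) (J′-indep : Independent G J′)
                     (ab : Slide I J a b) (ab′ : Slide I J′ a b′)
                     (b≢b′ : b ≢ b′) (¬bb′ : ¬ Adj G b b′) (c∈I : c ∈ I) (c≢a : c ≢ a) where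

    -- This is `I − a − c + b + b′`, written as `J′` with `c` exchanged for `b`, so that its size
    -- and most of its independence come from `J′`.
    K : Subset n
    K = (J′ - c) ∪ ⁅ b ⁆

    ∈K⁻ : ∀ {x} → x ∈ K → (x ∈ J′ × x ≢ c) ⊎ x ≡ b
    ∈K⁻ {x} x∈K with x∈p∪q⁻ (J′ - c) ⁅ b ⁆ x∈K
    ... | inj₂ x∈b = inj₂ (x∈⁅y⁆⇒x≡y b x∈b)
    ... | inj₁ x∈J′-c = inj₁ (p─q⊆p J′ ⁅ c ⁆ x∈J′-c ,
      λ x≡c → x∈p─q⇒x∉q J′ ⁅ c ⁆ x∈J′-c (subst (_∈ ⁅ c ⁆) (sym x≡c) (x∈⁅x⁆ c)))

    ∈K⁺ : ∀ {x} → x ∈ J′ → x ≢ c → x ∈ K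
    ∈K⁺ x∈J′ x≢c = x∈p∪q⁺ (inj₁ (x∈p∧x≢y⇒x∈p-y x∈J′ x≢c))

    b∈K : b ∈ K
    b∈K = x∈p∪q⁺ (inj₂ (x∈⁅x⁆ b))

    b∉I : b ∉ I
    b∉I = ∉ʳ (enter ab)

    b′∉I : b′ ∉ I
    b′∉I = ∉ʳ (enter ab′)

    c∈J′ : c ∈ J′
    c∈J′ = others (leave ab′) c∈I c≢a

    b∉J′ : b ∉ J′
    b∉J′ = Fork.b∉J′ ab ab′ b≢b′

    c∉K : c ∉ K
    c∉K c∈K = [ (λ (_ , c≢c) → c≢c refl) , (λ c≡b → b∉I (subst (_∈ I) c≡b c∈I)) ]′ (∈K⁻ c∈K)

    b′∈K : b′ ∈ K
    b′∈K = ∈K⁺ (∈ˡ (enter ab′)) λ b′≡c → b′∉I (subst (_∈ I) (sym b′≡c) c∈I)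

    ∣K∣≡∣J′∣ : ∣ K ∣ ≡ ∣ J′ ∣
    ∣K∣≡∣J′∣ = differences⇒∣p∣≡∣q∣
      (record { ∈ˡ = b∈K ; ∉ʳ = b∉J′ ; unique = λ x∈K x∉J′ →
        [ (λ (x∈J′ , _) → contradiction x∈J′ x∉J′) , id ]′ (∈K⁻ x∈K) })
      (record { ∈ˡ = c∈J′ ; ∉ʳ = c∉K ; unique = λ {x} x∈J′ x∉K →
        decidable-stable (x ≟ c) (x∉K ∘ ∈K⁺ x∈J′) })

    -- Apart from `b′`, which is not adjacent to `b` by hypothesis, the elements of `J′` lie in `J`
    -- together with `b`.
    b-free : ∀ {x} → x ∈ J′ → ¬ Adj G b x
    b-free {x} x∈J′ bx = J-indep (∈ˡ (enter ab)) (Fork.stays ab′ ab x∈J′ x≢b′) bx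
      where
      x≢b′ : x ≢ b′
      x≢b′ refl = ¬bb′ bx

    K-independent : Independent G K
    K-independent x∈K y∈K xy with ∈K⁻ x∈K | ∈K⁻ y∈K
    ... | inj₁ (x∈J′ , _) | inj₁ (y∈J′ , _) = J′-indep x∈J′ y∈J′ xy
    ... | inj₁ (x∈J′ , _) | inj₂ refl       = b-free x∈J′ (adj-sym G xy)
    ... | inj₂ refl       | inj₁ (y∈J′ , _) = b-free y∈J′ xy
    ... | inj₂ refl       | inj₂ refl       = adj-irrefl G refl xy

    K≢I : K ≢ I
    K≢I K≡I = b∉I (subst (b ∈_) K≡I b∈K)

    -- A slide brings in one vertex, but `b` and `b′` are both new in `K`.
    ¬tokenSlide : ¬ TokenSlide G I K
    ¬tokenSlide slide = b≢b′ (trans (unique (enter IK) b∈K b∉I) (sym (unique (enter IK) b′∈K b′∉I)))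
      where
      IK : Slide I K _ _
      IK = tokenSlide⇒slide slide

    -- The token `c` stays in place in both slides, so it shares `J` with `b` and `J′` with `b′`.
    c-free : ∀ {y} → y ≡ b ⊎ y ≡ b′ → ¬ Adj G c y
    c-free (inj₁ refl) = J-indep (others (leave ab) c∈I c≢a) (∈ˡ (enter ab))
    c-free (inj₂ refl) = J′-indep c∈J′ (∈ˡ (enter ab′))

    -- The two slides of a path from I to K would bring in b and b′, and one
    -- of them would move c, which is adjacent to neither.
    ¬twoSlides : ∀ {P x y u w} → Slide I P x y → Slide P K u w → ⊥
    ¬twoSlides {P} {x} {y} {u} {w} IP PK = c-free w∈ (subst (λ u → Adj G u w) u≡c (edge PK))
      where
      y-if : ∀ {z} → z ∈ P → z ∉ I → y ≡ z
      y-if z∈P z∉I = sym (unique (enter IP) z∈P z∉I)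

      w-if : ∀ {z} → z ∈ K → z ∉ P → w ≡ z
      w-if z∈K z∉P = sym (unique (enter PK) z∈K z∉P)

      -- Each slide brings in a single vertex, so `P` contains exactly one of `b` and `b′`.
      entering : (y ≡ b ⊎ y ≡ b′) × (w ≡ b ⊎ w ≡ b′)
      entering with b ∈? P | b′ ∈? P
      ... | yes b∈P | no b′∉P  = inj₁ (y-if b∈P b∉I) , inj₂ (w-if b′∈K b′∉P)
      ... | no b∉P  | yes b′∈P = inj₂ (y-if b′∈P b′∉I) , inj₁ (w-if b∈K b∉P)
      ... | yes b∈P | yes b′∈P =
        contradiction (trans (sym (y-if b∈P b∉I)) (y-if b′∈P b′∉I)) b≢b′
      ... | no b∉P  | no b′∉P  =
        contradiction (trans (sym (w-if b∈K b∉P)) (w-if b′∈K b′∉P)) b≢b′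

      w∈ : w ≡ b ⊎ w ≡ b′
      w∈ = proj₂ entering

      x≢c : x ≢ c
      x≢c refl = c-free (proj₁ entering) (edge IP)

      -- The first slide leaves `c` in `P`, and `c` is missing from `K`, so the second slide must
      -- move it.
      u≡c : u ≡ c
      u≡c = sym (unique (leave PK) (others (leave IP) c∈I (≢-sym x≢c)) c∉K)

-- Neighbours of `p₂` move distinct tokens

module _ {r s : ℕ} (G : SimpleGraph (Fin n)) (2≤k : 2 ≤ k) (iso : D[ r ,2, s ] ≅ TS G k) where

  open Inverse (proj₁ iso) using (to; from; strictlyInverseˡ; strictlyInverseʳ)

  node : DVertex r s → Subset n
  node d = value (to d)

  node-injective : ∀ {d e} → node d ≡ node e → d ≡ e
  node-injective {d} {e} eq = trans (sym (strictlyInverseʳ d))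
    (trans (cong from (value-injective eq)) (strictlyInverseʳ e))

  adj⇒slide : ∀ {d e} → Adj D[ r ,2, s ] d e → TokenSlide G (node d) (node e)
  adj⇒slide {d} {e} = Equivalence.to (proj₂ iso d e)

  slide⇒adj : ∀ {d e} → TokenSlide G (node d) (node e) → Adj D[ r ,2, s ] d e
  slide⇒adj {d} {e} = Equivalence.from (proj₂ iso d e)

  neighbour : Fin (suc s) → DVertex r s
  neighbour zero    = p₁
  neighbour (suc j) = leaf₂ j

  neighbour-adj : ∀ i → Adj D[ r ,2, s ] p₂ (neighbour i)
  neighbour-adj zero    = bwd p₁p₂
  neighbour-adj (suc j) = fwd (p₂leaf₂ j)

  neighbour-injective : ∀ {i j} → neighbour i ≡ neighbour j → i ≡ j
  neighbour-injective {zero}  {zero}  _    = refl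
  neighbour-injective {suc _} {suc _} refl = refl

  neighbours-¬adj : ∀ i j → ¬ Adj D[ r ,2, s ] (neighbour i) (neighbour j)
  neighbours-¬adj zero    zero    (fwd ())
  neighbours-¬adj zero    zero    (bwd ())
  neighbours-¬adj zero    (suc _) (fwd ())
  neighbours-¬adj zero    (suc _) (bwd ())
  neighbours-¬adj (suc _) zero    (fwd ())
  neighbours-¬adj (suc _) zero    (bwd ())
  neighbours-¬adj (suc _) (suc _) (fwd ())
  neighbours-¬adj (suc _) (suc _) (bwd ())

  -- Every vertex is within distance two of `p₂`, and distance two is reached only through `p₁`. The
  -- three cases are those refuted for `K` by `K≢I`, `¬tokenSlide` and `¬twoSlides`.
  near : ∀ d → d ≡ p₂ ⊎ Adj D[ r ,2, s ] p₂ d ⊎ Adj D[ r ,2, s ] p₁ d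
  near p₁        = inj₂ (inj₁ (bwd p₁p₂))
  near p₂        = inj₁ refl
  near (leaf₁ i) = inj₂ (inj₂ (fwd (p₁leaf₁ i)))
  near (leaf₂ j) = inj₂ (inj₁ (fwd (p₂leaf₂ j)))

  slide : ∀ i → TokenSlide G (node p₂) (node (neighbour i))
  slide i = adj⇒slide (neighbour-adj i)

  source target : Fin (suc s) → Fin n
  source i = proj₁ (slide i)
  target i = proj₁ (proj₂ (slide i))

  slideAt : ∀ i → Slide G (node p₂) (node (neighbour i)) (source i) (target i)
  slideAt i = tokenSlide⇒slide G (slide i)

  source-injective : ∀ {i j} → source i ≡ source j → i ≡ j
  source-injective {i} {j} same = decidable-stable (i ≟ j) unreachable
    where
    J J′ : Subset n
    J  = node (neighbour i)
    J′ = node (neighbour j)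

    ab : Slide G (node p₂) J (source i) (target i)
    ab = slideAt i

    ab′ : Slide G (node p₂) J′ (source i) (target j)
    ab′ = subst (λ a → Slide G (node p₂) J′ a (target j)) (sym same) (slideAt j)

    target≢ : i ≢ j → target i ≢ target j
    target≢ i≢j b≡b′ = i≢j (neighbour-injective (node-injective
      (⊆-antisym (Fork.J⊆J′ G ab ab′ b≡b′) (Fork.J⊆J′ G ab′ ab (sym b≡b′)))))

    -- An edge between the targets would make `J` and `J′` adjacent nodes, closing a triangle with
    -- `p₂`.
    target-¬adj : i ≢ j → ¬ Adj G (target i) (target j)
    target-¬adj i≢j bb′ = neighbours-¬adj i j (slide⇒adj
      ( target i , target j
      , difference⇒≡ (Fork.difference G ab ab′ (target≢ i≢j))
      , difference⇒≡ (Fork.difference G ab′ ab (≢-sym (target≢ i≢j)))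
      , bb′ ))

    unreachable : i ≢ j → ⊥
    -- Since `k` is at least 2, there is a second token `c`, and `K` becomes a node that no vertex
    -- `d` of the broom can represent.
    unreachable i≢j with (c , c∈I , c≢a) ← another-element (node p₂) (source i)
                           (subst (2 ≤_) (sym (size G (to p₂))) 2≤k) =
      [ (λ d≡p₂ → K≢I (trans (sym node-d) (cong node d≡p₂)))
      , [ (λ adj → ¬tokenSlide (subst (TokenSlide G (node p₂)) node-d (adj⇒slide adj)))
        , (λ adj → ¬twoSlides (tokenSlide⇒slide G (adj⇒slide (bwd p₁p₂)))
                     (tokenSlide⇒slide G (subst (TokenSlide G (node p₁)) node-d (adj⇒slide adj))))
        ]′
      ]′ (near d)
      where
      open DoubleSlide G (independent G (to (neighbour i))) (independent G (to (neighbour j)))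
             ab ab′ (target≢ i≢j) (target-¬adj i≢j) c∈I c≢a

      K-node : IndependentSet G k
      K-node = K , [ (λ {u} {v} → K-independent {u} {v})
                   , trans ∣K∣≡∣J′∣ (size G (to (neighbour j))) ]

      d : DVertex r s
      d = from K-node

      node-d : node d ≡ K
      node-d = cong value (strictlyInverseˡ K-node)

  -- The `s` leaves and `p₁` make `s + 1` neighbours, whose sources are distinct elements of a set
  -- of size `k`.
  degree-p₂≤k : suc s ≤ k
  degree-p₂≤k = subst (suc s ≤_) (size G (to p₂))
    (injection⇒≤∣p∣ source source-injective λ i → Difference.∈ˡ (Slide.leave (slideAt i)))

proposition30 : ∀ (k r s : ℕ) → 2 ≤ k → 1 ≤ r → r ≤ s →
    IsTSGraph k D[ r ,2, s ] ⇔ s ≤ k ∸ 1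
-- Matching exposes `k` as a double successor, so that `k ∸ 1` computes to the `suc m` of
-- `Realisation`.
proposition30 _ r s 2≤k@(s≤s (s≤s _)) _ r≤s = mk⇔
  (λ (_ , G , iso) → s≤s⁻¹ (degree-p₂≤k G 2≤k iso))
  (λ s≤k-1 → Realisation.D-isTSGraph (ℕ.≤-trans r≤s s≤k-1) s≤k-1)
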